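{- For the planning version of the graph exploration problem with predictions (defined in the context), there is an algorithm whose total movement cost until reaching the goal is at most (i) $d(r,g)+O(\Delta\cdot|\mathcal{E}|)$ if the graph is a tree with maximum degree $\Delta$ (unit edge lengths); (ii) $d(r,g)+2^{O(\alpha)}\cdot O(|\mathcal{E}|^2)$ if the graph (with unit edge lengths) has doubling dimension $\alpha$, where $\mathcal{E}=\{v\in V\mid f(v)\neq d(v,g)\}$.
   Context: Planning problem: an agent knows up front a connected graph $G=(V,E)$ with unit edge lengths, a root $r\in V$, and a prediction $f(v)\in\mathbb{Z}$ for every vertex $v$ (intended to be the distance $d(v,g)$ from $v$ to an unknown goal vertex $g$). The agent starts at $r$ and visits vertices one at a time, $v_0=r,v_1,v_2,\dots$, paying $d(v_{t-1},v_t)$ (shortest-path distance) for each move; it learns that a vertex is the goal only upon visiting it, and the cost is the total distance traveled until it visits $g$. The set of erroneous vertices is $\mathcal{E}=\{v\in V\mid f(v)\neq d(v,g)\}$. The doubling dimension of $G$ is the smallest $\alpha$ such that, in the shortest-path metric, every ball of radius $2R$ can be covered by at most $2^\alpha$ balls of radius $R$. -}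

module Defs where

open import Data.Nat using (ℕ; zero; suc; _+_; _*_; _≤_; _⊔_; _/_)
open import Data.Bool using (Bool; true; false; _∨_; _∧_; if_then_else_)
open import Data.Fin using (Fin; _≟_)
open import Data.Integer using (ℤ) renaming (+_ to ℤ+_)
import Data.Integer as ℤ
open import Data.List using (List; []; _∷_; [_]; _++_; length; map; foldr; allFin)
open import Data.Bool.ListAction using (any)
open import Data.Nat.ListAction using (sum)
open import Data.List.Relation.Unary.Any using (Any)
open import Data.List.Relation.Unary.Unique.Propositional using (Unique)
open import Data.Maybe using (Maybe; just; nothing)
import Data.Maybe as Maybe
open import Data.Product using (Σ; _×_; ∃)
open import Data.Unit using (⊤)
open import Relation.Binary.PropositionalEquality using (_≡_)
open import Relation.Nullary using (¬_; yes; no)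
open import Relation.Nullary.Decidable using (⌊_⌋)

record Graph (n : ℕ) : Set where
  field
    adj    : Fin n → Fin n → Bool
    sym    : ∀ u v → adj u v ≡ adj v u
    irrefl : ∀ v → adj v v ≡ false
open Graph public

module _ {n : ℕ} (G : Graph n) where

  reach : ℕ → Fin n → Fin n → Bool
  reach zero    u v = ⌊ u ≟ v ⌋
  reach (suc k) u v = reach k u v ∨ any (λ w → adj G u w ∧ reach k w v) (allFin n)

  search : Fin n → Fin n → ℕ → ℕ → ℕ
  search u v k zero       = k
  search u v k (suc fuel) = if reach k u v then k else search u v (suc k) fuel

  -- shortest-path distance (least number of edges of a u-v walk);
  -- in a connected graph this is always < n.
  dist : Fin n → Fin n → ℕ
  dist u v = search u v 0 n

  Connected : Set
  Connected = ∀ u v → ∃ λ k → reach k u v ≡ true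

  Chain : List (Fin n) → Set
  Chain []           = ⊤
  Chain (x ∷ [])     = ⊤
  Chain (x ∷ y ∷ zs) = adj G x y ≡ true × Chain (y ∷ zs)

  HasCycle : Set
  HasCycle = Σ (Fin n) λ x → Σ (List (Fin n)) λ xs →
               2 ≤ length xs × Unique (x ∷ xs) × Chain (x ∷ xs ++ [ x ])

  IsTree : Set
  IsTree = Connected × ¬ HasCycle

  degree : Fin n → ℕ
  degree v = sum (map (λ w → if adj G v w then 1 else 0) (allFin n))

  maxDegree : ℕ
  maxDegree = foldr _⊔_ 0 (map degree (allFin n))

  errors : (Fin n → ℤ) → Fin n → ℕ
  errors f g = sum (map (λ v → if ⌊ f v ℤ.≟ ℤ+ dist v g ⌋ then 0 else 1) (allFin n))

  -- Every ball of radius 2R (R > 0 real) is covered by ≤ 2^α balls of radius R.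
  -- Since distances are integers, B(x,2R) = B(x,m) with m = ⌊2R⌋ and
  -- B(y,R) = B(y,⌊m/2⌋); so quantifying over all m ∈ ℕ is exactly this.
  Doubling : ℕ → Set
  Doubling α = ∀ (x : Fin n) (m : ℕ) → Σ (List (Fin n)) λ cs →
                 length cs ≤ 2 Data.Nat.^ α ×
                 (∀ v → dist x v ≤ m → Any (λ c → dist c v ≤ m / 2) cs)

  IsDoublingDim : ℕ → Set
  IsDoublingDim α = Doubling α × (∀ β → Doubling β → α ≤ β)

  costTo : Fin n → Fin n → List (Fin n) → Maybe ℕ
  costTo g cur vs with cur ≟ g
  ... | yes _ = just 0
  costTo g cur []       | no _ = nothing
  costTo g cur (v ∷ vs) | no _ = Maybe.map (λ c → dist cur v Data.Nat.+ c) (costTo g v vs)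

-- A (deterministic) planning algorithm: knowing G, the root r and the predictions f
-- up front, it fixes the order v₁, v₂, … in which to visit vertices (the only
-- feedback before reaching the goal is "not the goal", so this is fully general).
Algorithm : Set
Algorithm = (n : ℕ) → Graph n → Fin n → (Fin n → ℤ) → List (Fin n)

CostAtMost : Algorithm → (n : ℕ) → Graph n → Fin n → (Fin n → ℤ) → Fin n → ℕ → Set
CostAtMost A n G r f g bound =
  Σ ℕ λ c → costTo G g r (A n G r f) ≡ just c × c ≤ bound

{-# OPTIONS --safe #-}

-- Let φ v be the number of predictions that are wrong if v is the goal. A vertex whose distances to u and v
-- differ has a wrong prediction for one of the two goals, so φ u + φ v bounds the number of such vertices;
-- half of a shortest u-v path consists of them, whence d(u,v) ≤ 2 (φ u + φ v). The agent first visits a vertex v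
-- minimising φ and then makes, for m doubling from φ v + 1 on, a round trip from v through {φ ≤ m}. The costs B m
-- of these trips at least double from trip to trip, so up to a constant only the last one counts.
--
-- Doubling metrics: let {φ ≤ m} have radius R about v. Each of its points x has a candidate at distance ≥ R/2,
-- which is separated from x by all vertices close to x; so a ball of radius R/16 contains at most 2m candidates.
-- Covering the R-ball by 2^(4α) such balls bounds the number of candidates, and any order of visit will do.
--
-- Trees: let c be a vertex minimising the radius of {φ ≤ m}, and walk around the union of the shortest paths from c
-- to the candidates. For a neighbour b of c whose branch contains a candidate s, minimality gives a candidate u
-- outside the branch that is not closer to c than s by more than 1. Every vertex of the branch is strictly closer
-- to s than to u, so each of the at most Δ branches has at most 2m vertices.

module Submission where

open import Defs
open import Data.Nat using (ℕ; _+_; _*_; _^_)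
open import Data.Fin using (Fin)
open import Data.Integer using (ℤ)
open import Data.Product using (Σ; _×_)

open import Data.Bool using (true; false; _∧_; if_then_else_)
import Data.Bool.Properties as Bool
open import Data.Fin using (toℕ; _≟_)
open import Data.Fin.Properties using (any?; toℕ-injective; toℕ≤pred[n]; injective⇒≤)
open import Data.Integer using () renaming (+_ to ℤ+_)
import Data.Integer as ℤ
import Data.Integer.Properties as ℤ
open import Data.List using (List; []; _∷_; [_]; _++_; length; map; foldr; filter; allFin; concatMap)
open import Data.List.Membership.Propositional using (_∈_; lose; find)
open import Data.List.Membership.Propositional.Properties using (∈-allFin; ∈-filter⁺; ∈-concatMap⁺)
open import Data.List.Properties using (length-tabulate; length-++; ++-identityʳ)
open import Data.List.Relation.Unary.All as All using (All; []; _∷_)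
open import Data.List.Relation.Unary.All.Properties using (all-filter)
open import Data.List.Relation.Unary.AllPairs using ([]; _∷_)
open import Data.List.Relation.Unary.Any using (here; there; satisfied)
import Data.List.Relation.Unary.Any.Properties as Any
open import Data.List.Relation.Unary.Unique.Propositional using (Unique)
import Data.List.Relation.Unary.Unique.Propositional.Properties as Unique
open import Data.Maybe using (just)
open import Data.Nat using (zero; suc; _≤_; _<_; _/_; _⊔_; z≤n; s≤s; s≤s⁻¹; _≤?_; _<?_)
import Data.Nat as ℕ
open import Data.Nat.DivMod using (m/n*n≤m)
open import Data.Nat.ListAction using (sum)
open import Data.Nat.Properties hiding (_≟_)
open import Data.List.Extrema ≤-totalOrder
  using (argmin; argmax; f[argmin]≤f[xs]; f[xs]≤f[argmax]; argmax-all)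
open import Data.Nat.Tactic.RingSolver using (solve-∀)
open import Data.Product using (∃; _,_; proj₁; proj₂)
open import Data.Sum using (_⊎_; inj₁; inj₂)
open import Data.Unit using (tt)
open import Function using (_∘_; id)
open import Function.Bundles using (Equivalence)
open import Relation.Binary.PropositionalEquality
  using (_≡_; _≢_; refl; trans; cong; cong₂; subst) renaming (sym to ≡-sym)
open import Relation.Nullary using (¬_; Dec; yes; no; does; contradiction)
open import Relation.Nullary.Decidable using (⌊_⌋; _×-dec_; ¬?)
open import Relation.Unary using (Decidable)

-- Sums and counting

module _ {A : Set} where

  sum-mono : {F H : A → ℕ} → (∀ x → F x ≤ H x) → ∀ xs → sum (map F xs) ≤ sum (map H xs)
  sum-mono F≤H []       = z≤n
  sum-mono F≤H (x ∷ xs) = +-mono-≤ (F≤H x) (sum-mono F≤H xs)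

  sum-+ : (F H : A → ℕ) → ∀ xs → sum (map (λ x → F x + H x) xs) ≡ sum (map F xs) + sum (map H xs)
  sum-+ F H []       = refl
  sum-+ F H (x ∷ xs) rewrite sum-+ F H xs = interchange (F x) (H x) _ _
    where
    interchange : ∀ a b c d → (a + b) + (c + d) ≡ (a + c) + (b + d)
    interchange = solve-∀

  sum-const : ∀ b (xs : List A) → sum (map (λ _ → b) xs) ≡ length xs * b
  sum-const b []       = refl
  sum-const b (x ∷ xs) = cong (b +_) (sum-const b xs)

  sum-*ʳ : (F : A → ℕ) → ∀ b xs → sum (map (λ x → F x * b) xs) ≡ sum (map F xs) * b
  sum-*ʳ F b []       = refl
  sum-*ʳ F b (x ∷ xs) = trans (cong (F x * b +_) (sum-*ʳ F b xs)) (≡-sym (*-distribʳ-+ b (F x) _))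

  term≤sum : (F : A → ℕ) → ∀ {x xs} → x ∈ xs → F x ≤ sum (map F xs)
  term≤sum F (here refl)        = m≤m+n _ _
  term≤sum F {xs = y ∷ _} (there x∈xs) = ≤-trans (term≤sum F x∈xs) (m≤n+m _ (F y))

  ≤-foldr-⊔ : (F : A → ℕ) → ∀ {x xs} → x ∈ xs → F x ≤ foldr _⊔_ 0 (map F xs)
  ≤-foldr-⊔ F (here refl)  = m≤m⊔n _ _
  ≤-foldr-⊔ F {xs = y ∷ _} (there x∈xs) = ≤-trans (≤-foldr-⊔ F x∈xs) (m≤n⊔m (F y) _)

sum-swap : {A B : Set} (F : A → B → ℕ) → ∀ xs ys →
           sum (map (λ x → sum (map (F x) ys)) xs) ≡ sum (map (λ y → sum (map (λ x → F x y) xs)) ys)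
sum-swap F []       ys = ≡-sym (trans (sum-const 0 ys) (*-zeroʳ (length ys)))
sum-swap F (x ∷ xs) ys =
  trans (cong (sum (map (F x) ys) +_) (sum-swap F xs ys))
        (≡-sym (sum-+ (F x) (λ y → sum (map (λ z → F z y) xs)) ys))

indicator : {P : Set} → Dec P → ℕ
indicator P? = if does P? then 1 else 0

indicator-≤ : {P : Set} {P? : Dec P} → ∀ {k} → (P → 1 ≤ k) → indicator P? ≤ k
indicator-≤ {P? = yes p} P→ = P→ p
indicator-≤ {P? = no _}  P→ = z≤n

indicator-yes : {P : Set} {P? : Dec P} → P → 1 ≤ indicator P?
indicator-yes {P? = yes _} p = ≤-refl
indicator-yes {P? = no ¬p} p = contradiction p ¬p

module _ {A : Set} where

  -- A sum of indicators, the same form as `errors`, so that the two can be compared term by term.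
  count : {P : A → Set} → Decidable P → List A → ℕ
  count P? xs = sum (map (λ x → indicator (P? x)) xs)

  length-filter≡count : {P : A → Set} (P? : Decidable P) → ∀ xs → length (filter P? xs) ≡ count P? xs
  length-filter≡count P? []       = refl
  length-filter≡count P? (x ∷ xs) with P? x
  ... | yes _ = cong suc (length-filter≡count P? xs)
  ... | no  _ = length-filter≡count P? xs

  -- Union bound: every counted `x` contributes at least 1 to its inner sum over `bs`; then the two
  -- sums are exchanged.
  count-cover : {B : Set} {P : A → Set} {Q : B → A → Set} {P? : Decidable P}
                {Q? : ∀ b → Decidable (Q b)} → ∀ (bs : List B) xs → (∀ {x} → P x → ∃ λ b → b ∈ bs × Q b x) →
                count P? xs ≤ sum (map (λ b → count (Q? b) xs) bs)
  count-cover {P? = P?} {Q?} bs xs cover = begin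
    count P? xs                                                  ≤⟨ sum-mono covered xs ⟩
    sum (map (λ x → sum (map (λ b → indicator (Q? b x)) bs)) xs) ≡⟨ sum-swap _ xs bs ⟩
    sum (map (λ b → count (Q? b) xs) bs)                         ∎
    where
    open ≤-Reasoning
    covered : ∀ x → indicator (P? x) ≤ sum (map (λ b → indicator (Q? b x)) bs)
    covered x = indicator-≤ {P? = P? x} λ px → let b , b∈bs , qbx = cover px in
      ≤-trans (indicator-yes {P? = Q? b x} qbx) (term≤sum (λ b → indicator (Q? b x)) b∈bs)

  count-disjoint : {P Q R : A → Set} {P? : Decidable P} {Q? : Decidable Q} {R? : Decidable R} →
                   (∀ {x} → P x → R x) → (∀ {x} → Q x → R x) → (∀ {x} → P x → ¬ Q x) →
                   ∀ xs → count P? xs + count Q? xs ≤ count R? xs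
  count-disjoint {P? = P?} {Q?} {R?} P⊆R Q⊆R P∩Q=∅ xs =
    ≤-trans (≤-reflexive (≡-sym (sum-+ _ _ xs))) (sum-mono both xs)
    where
    both : ∀ x → indicator (P? x) + indicator (Q? x) ≤ indicator (R? x)
    both x with P? x | Q? x | R? x
    ... | no _  | no _  | _     = z≤n
    ... | yes p | yes q | _     = contradiction q (P∩Q=∅ p)
    ... | yes p | no _  | yes _ = ≤-refl
    ... | no _  | yes q | yes _ = ≤-refl
    ... | yes p | no _  | no ¬r = contradiction (P⊆R p) ¬r
    ... | no _  | yes q | no ¬r = contradiction (Q⊆R q) ¬r

  ∈⇒1≤count : {P : A → Set} {P? : Decidable P} → ∀ {x xs} → x ∈ xs → P x → 1 ≤ count P? xs
  ∈⇒1≤count {P? = P?} {x} x∈xs px =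
    ≤-trans (indicator-yes {P? = P? x} px) (term≤sum (λ x → indicator (P? x)) x∈xs)

-- The count is 0 if nothing satisfies `P`, so a bound may be derived from an element at hand; later
-- such an element supplies the two goals to compare.
count-inhabited : ∀ {n k} {P : Fin n → Set} (P? : Decidable P) →
                  (∀ {x} → P x → count P? (allFin n) ≤ k) → count P? (allFin n) ≤ k
count-inhabited {n} P? bound with any? P?
... | yes (x , px) = bound px
... | no  none     = ≤-trans (sum-mono (λ x → indicator-≤ {P? = P? x} λ px → contradiction (x , px) none) (allFin n))
                             (≤-trans (≤-reflexive (trans (sum-const 0 (allFin n)) (*-zeroʳ (length (allFin n))))) z≤n)

foldr-⊔-≤ : {A : Set} (F : A → ℕ) → ∀ {k xs} → All (λ x → F x ≤ k) xs → foldr _⊔_ 0 (map F xs) ≤ k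
foldr-⊔-≤ F []         = z≤n
foldr-⊔-≤ F (px ∷ pxs) = ⊔-lub px (foldr-⊔-≤ F pxs)

foldr-⊔-< : {A : Set} (F : A → ℕ) → ∀ {k xs} → 0 < k → All (λ x → F x < k) xs → foldr _⊔_ 0 (map F xs) < k
foldr-⊔-< F 0<k []         = 0<k
foldr-⊔-< F 0<k (px ∷ pxs) = ⊔-pres-<m px (foldr-⊔-< F 0<k pxs)

length-concatMap-≤ : {A B : Set} (h : A → List B) → ∀ {b} → (∀ x → length (h x) ≤ b) →
                     ∀ xs → length (concatMap h xs) ≤ length xs * b
length-concatMap-≤ h h≤ []       = z≤n
length-concatMap-≤ h h≤ (x ∷ xs) =
  ≤-trans (≤-reflexive (length-++ (h x))) (+-mono-≤ (h≤ x) (length-concatMap-≤ h h≤ xs))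

-- Shortest-path distance

module _ {n : ℕ} (G : Graph n) where

  Adj : Fin n → Fin n → Set
  Adj u v = adj G u v ≡ true

  Adj-sym : ∀ {u v} → Adj u v → Adj v u
  Adj-sym {u} {v} uv = trans (sym G v u) uv

  Reach : ℕ → Fin n → Fin n → Set
  Reach k u v = reach G k u v ≡ true

  reach-refl : ∀ v → Reach 0 v v
  reach-refl v with v ≟ v
  ... | yes _  = refl
  ... | no v≢v = contradiction refl v≢v

  reach-zero⁻ : ∀ {u v} → Reach 0 u v → u ≡ v
  reach-zero⁻ {u} {v} r with yes u≡v ← u ≟ v = u≡v

  reach-suc⁻ : ∀ {k u v} → Reach (suc k) u v → Reach k u v ⊎ ∃ λ w → Adj u w × Reach k w v
  reach-suc⁻ {k} {u} {v} r with reach G k u v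
  ... | true  = inj₁ refl
  ... | false with satisfied (Any.any⁻ _ (allFin n) (Equivalence.from Bool.T-≡ r))
  ...   | w , Tw with Equivalence.to Bool.T-∧ Tw
  ...     | uw , wv = inj₂ (w , Equivalence.to Bool.T-≡ uw , Equivalence.to Bool.T-≡ wv)

  reach-suc : ∀ {k u v} → Reach k u v → Reach (suc k) u v
  reach-suc r rewrite r = refl

  reach-step : ∀ {k u v w} → Adj u w → Reach k w v → Reach (suc k) u v
  reach-step {k} {u} {v} {w} uw r
    rewrite Equivalence.to Bool.T-≡ (Any.any⁺ (λ x → adj G u x ∧ reach G k x v) (lose (∈-allFin w)
              (Equivalence.from Bool.T-∧ (Equivalence.from Bool.T-≡ uw , Equivalence.from Bool.T-≡ r))))
    = Bool.∨-zeroʳ (reach G k u v)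

  reach-trans : ∀ {j k u v w} → Reach j u v → Reach k v w → Reach (j + k) u w
  reach-trans {zero} {k} {w = w} uv vw = subst (λ x → Reach k x w) (≡-sym (reach-zero⁻ uv)) vw
  reach-trans {suc j} {k} uv vw with reach-suc⁻ {j} uv
  ... | inj₁ uv′            = reach-suc {j + k} (reach-trans {j} uv′ vw)
  ... | inj₂ (x , ux , xv) = reach-step {j + k} ux (reach-trans {j} xv vw)

  reach-sym : ∀ {k u v} → Reach k u v → Reach k v u
  reach-sym {zero} uv with refl ← reach-zero⁻ uv = uv
  reach-sym {suc k} {u} {v} uv with reach-suc⁻ {k} uv
  ... | inj₁ uv′           = reach-suc {k} (reach-sym {k} uv′)
  ... | inj₂ (x , ux , xv) = subst (λ j → Reach j v u) (+-comm k 1)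
    (reach-trans {k} (reach-sym {k} xv) (reach-step {0} (Adj-sym ux) (reach-refl u)))

  search-least : ∀ {u v j} k fuel → Reach j u v → k ≤ j → search G u v k fuel ≤ j
  search-least             k zero       r k≤j = k≤j
  search-least {u} {v} {j} k (suc fuel) r k≤j with reach G k u v in eq
  ... | true  = k≤j
  ... | false = search-least (suc k) fuel r
    -- The test at `k` has just failed while `r` says that it succeeds at `j`, so `k` and `j`
    -- differ.
    (≤∧≢⇒< k≤j λ { refl → contradiction (trans (≡-sym r) eq) λ () })

  search-reach : ∀ {u v} k fuel → search G u v k fuel ≡ k + fuel ⊎ Reach (search G u v k fuel) u v
  search-reach         k zero       = inj₁ (≡-sym (+-identityʳ k))
  search-reach {u} {v} k (suc fuel) with reach G k u v in eq
  ... | true  = inj₂ eq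
  ... | false with search-reach {u} {v} (suc k) fuel
  ...   | inj₁ e = inj₁ (trans e (≡-sym (+-suc k fuel)))
  ...   | inj₂ r = inj₂ r

  -- The exact distance, stated without the fuel `n` of `dist`; it serves to show that this fuel
  -- suffices.
  Least : ℕ → Fin n → Fin n → Set
  Least k u v = Reach k u v × (∀ {j} → Reach j u v → k ≤ j)

  -- The search is run with fuel `k`, the length of a known walk. If the fuel runs out, the result
  -- is `k` itself, which is then minimal by `search-least`.
  reach⇒least : ∀ {k u v} → Reach k u v → ∃ λ e → Least e u v
  reach⇒least {k} {u} {v} r with search-reach {u} {v} 0 k
  ... | inj₁ e  = k , r , λ r′ → subst (_≤ _) e (search-least 0 k r′ z≤n)
  ... | inj₂ r′ = search G u v 0 k , r′ , λ r″ → search-least 0 k r″ z≤n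

  least-suc : ∀ {k u v} → Least (suc k) u v → ∃ λ w → Adj u w × Least k w v
  least-suc {k} (r , min) with reach-suc⁻ {k} r
  ... | inj₁ r′            = contradiction (min r′) 1+n≰n
  ... | inj₂ (w , uw , wv) = w , uw , wv , λ {j} r′ → s≤s⁻¹ (min (reach-step {j} uw r′))

  least-level : ∀ {k u v i} → Least k u v → i ≤ k → ∃ λ w → Least i w v
  least-level {zero}  {u} l z≤n = u , l
  least-level {suc k} {u} l i≤k with m≤n⇒m<n∨m≡n i≤k
  ... | inj₂ refl      = u , l
  ... | inj₁ (s≤s i≤k) = least-level (proj₂ (proj₂ (least-suc l))) i≤k

  -- The vertices at the distances 0 , … , k from v on a shortest path are distinct.
  least<n : ∀ {k u v} → Least k u v → k < n
  least<n {k} {u} {v} l = injective⇒≤ {f = proj₁ ∘ level} λ {i} {j} eq →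
    toℕ-injective (same {toℕ i} {toℕ j} (proj₂ (level i)) (subst (λ w → Least (toℕ j) w v) (≡-sym eq) (proj₂ (level j))))
    where
    level : (i : Fin (suc k)) → ∃ λ w → Least (toℕ i) w v
    level i = least-level l (toℕ≤pred[n] i)
    same : ∀ {i j w} → Least i w v → Least j w v → i ≡ j
    same (r , min) (r′ , min′) = ≤-antisym (min r′) (min′ r)

module Metric {n : ℕ} (G : Graph n) (connected : Connected G) where

  private
    d : Fin n → Fin n → ℕ
    d = dist G

  d-least : ∀ {k u v} → Reach G k u v → d u v ≤ k
  d-least r = search-least G 0 n r z≤n

  -- A search that runs out of fuel would give `d u v ≡ n`, but the least walk length is below `n`
  -- by `least<n`.
  d-reach : ∀ u v → Reach G (d u v) u v
  d-reach u v with search-reach G {u} {v} 0 n | reach⇒least G {proj₁ (connected u v)} (proj₂ (connected u v))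
  ... | inj₂ r | _     = r
  ... | inj₁ e | k , l = contradiction (d-least {k} (proj₁ l)) (<⇒≱ (subst (k <_) (≡-sym e) (least<n G {k} l)))

  d≤n : ∀ u v → d u v ≤ n
  d≤n u v = ≤-trans (d-least {proj₁ e} (proj₁ l)) (<⇒≤ (least<n G {proj₁ e} l))
    where
    e = reach⇒least G {proj₁ (connected u v)} (proj₂ (connected u v))
    l = proj₂ e

  d-refl : ∀ v → d v v ≡ 0
  d-refl v = n≤0⇒n≡0 (d-least (reach-refl G v))

  d≡0⇒≡ : ∀ {u v} → d u v ≡ 0 → u ≡ v
  d≡0⇒≡ {u} {v} eq = reach-zero⁻ G (subst (λ k → Reach G k u v) eq (d-reach u v))

  d-sym : ∀ u v → d u v ≡ d v u
  d-sym u v = ≤-antisym (half v u) (half u v)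
    where
    half : ∀ u v → d v u ≤ d u v
    half u v = d-least (reach-sym G {d u v} (d-reach u v))

  d-triangle : ∀ u v w → d u w ≤ d u v + d v w
  d-triangle u v w = d-least (reach-trans G {d u v} {d v w} (d-reach u v) (d-reach v w))

  d-adj : ∀ {u v} → Adj G u v → d u v ≤ 1
  d-adj {u} {v} uv = d-least (reach-step G {0} uv (reach-refl G v))

  d-step : ∀ {k u v} → d u v ≡ suc k → ∃ λ w → Adj G u w × d w v ≡ k
  d-step {k} {u} {v} eq
    with least-suc G {k} (subst (λ j → Reach G j u v) eq (d-reach u v) , λ {j} r → subst (_≤ j) eq (d-least {j} r))
  ... | w , uw , r , min = w , uw , ≤-antisym (d-least {k} r) (min {d w v} (d-reach w v))

  d-adj-≤ : ∀ {u w} v → Adj G u w → d u v ≤ suc (d w v)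
  d-adj-≤ {u} {w} v uw = ≤-trans (d-triangle u w v) (+-monoˡ-≤ (d w v) (d-adj uw))

-- The doubling search

module _ {n : ℕ} (G : Graph n) where

  walk : Fin n → List (Fin n) → ℕ
  walk v []       = 0
  walk v (x ∷ xs) = dist G v x + walk x xs

  -- An upper bound instead of the exact cost: it stays valid if the agent meets `g` earlier than at
  -- the visit considered.
  record Finds (g v : Fin n) (xs : List (Fin n)) (b : ℕ) : Set where
    constructor finds
    field
      found-at-cost : Σ ℕ λ c → costTo G g v xs ≡ just c × c ≤ b

  costTo-here : ∀ g xs → costTo G g g xs ≡ just 0
  costTo-here g xs with g ≟ g
  costTo-here g xs      | no g≢g = contradiction refl g≢g
  costTo-here g []      | yes _  = refl
  costTo-here g (_ ∷ _) | yes _  = refl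

  finds-here : ∀ {g} xs {b} → Finds g g xs b
  finds-here {g} xs = finds (0 , costTo-here g xs , z≤n)

  finds-step : ∀ {g v x xs b} → Finds g x xs b → Finds g v (x ∷ xs) (dist G v x + b)
  finds-step {g} {v} {x} {xs} {b} (finds (c , eq , c≤b)) = finds cost
    where
    cost : Σ ℕ λ c → costTo G g v (x ∷ xs) ≡ just c × c ≤ dist G v x + b
    cost with v ≟ g
    ... | yes _ = 0 , refl , z≤n
    ... | no  _ rewrite eq = dist G v x + c , refl , +-monoʳ-≤ (dist G v x) c≤b

  finds-mono : ∀ {g v xs b b′} → b ≤ b′ → Finds g v xs b → Finds g v xs b′
  finds-mono b≤b′ (finds (c , eq , c≤b)) = finds (c , eq , ≤-trans c≤b b≤b′)

  finds-∈ : ∀ {g v xs ys} → g ∈ xs → Finds g v (xs ++ ys) (walk v xs)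
  finds-∈ {v = v} {x ∷ xs} {ys} (here refl)  = finds-step (finds-here (xs ++ ys))
  finds-∈ {xs = x ∷ xs} (there g∈xs) = finds-step (finds-∈ g∈xs)

  finds-++ : ∀ {g v x b} xs {ys} → Finds g x ys b → Finds g v (xs ++ x ∷ ys) (walk v (xs ++ [ x ]) + b)
  finds-++ {v = v} {x} {b} []  fd =
    finds-mono (≤-reflexive (cong (_+ b) (≡-sym (+-identityʳ (dist G v x))))) (finds-step fd)
  finds-++ {v = v} {x} {b} (y ∷ xs) fd =
    finds-mono (≤-reflexive (≡-sym (+-assoc (dist G v y) _ b))) (finds-step (finds-++ xs fd))

  module _ (tour : ℕ → List (Fin n)) (v : Fin n) where

    -- `fuel` limits the number of doublings. `plan` supplies `n`, which suffices because `errors`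
    -- is at most `n` and each doubling raises a positive `m`.
    doubling : ℕ → ℕ → List (Fin n)
    doubling zero       m = tour m
    doubling (suc fuel) m = tour m ++ v ∷ doubling fuel (m + m)

  module _ (f : Fin n → ℤ) where

    abstract
      best : Fin n → Fin n
      best r = argmin (errors G f) r (allFin n)

      best-least : ∀ r v → errors G f (best r) ≤ errors G f v
      best-least r v = All.lookup (f[argmin]≤f[xs] r (allFin n)) (∈-allFin v)

    plan : (Fin n → ℕ → List (Fin n)) → Fin n → List (Fin n)
    -- Starting at one more than the minimum makes the first bound positive, so that doubling
    -- increases it.
    plan tour r = best r ∷ doubling (tour (best r)) (best r) n (suc (errors G f (best r)))

-- Wrong predictions and distances

module Prediction {n : ℕ} (G : Graph n) (connected : Connected G) (f : Fin n → ℤ) where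

  open Metric G connected

  private
    d : Fin n → Fin n → ℕ
    d = dist G
    φ : Fin n → ℕ
    φ = errors G f

  errors≤n : ∀ v → φ v ≤ n
  errors≤n v = begin
    φ v                            ≤⟨ sum-mono indicator≤1 (allFin n) ⟩
    sum (map (λ _ → 1) (allFin n)) ≡⟨ sum-const 1 (allFin n) ⟩
    length (allFin n) * 1          ≡⟨ *-identityʳ _ ⟩
    length (allFin n)              ≡⟨ length-tabulate {n = n} id ⟩
    n                              ∎
    where
    open ≤-Reasoning
    indicator≤1 : ∀ w → (if ⌊ f w ℤ.≟ ℤ+ d w v ⌋ then 0 else 1) ≤ 1
    indicator≤1 w with f w ℤ.≟ ℤ+ d w v
    ... | yes _ = z≤n
    ... | no  _ = ≤-refl

  -- A correct prediction at w is correct for only one of two goals at different distances from w.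
  count-separated : ∀ {P : Fin n → Set} (P? : Decidable P) u v → (∀ {w} → P w → d w u ≢ d w v) →
                    count P? (allFin n) ≤ φ u + φ v
  count-separated P? u v separates =
    ≤-trans (sum-mono wrong (allFin n)) (≤-reflexive (sum-+ _ _ (allFin n)))
    where
    wrong : ∀ w → indicator (P? w) ≤ (if ⌊ f w ℤ.≟ ℤ+ d w u ⌋ then 0 else 1) + (if ⌊ f w ℤ.≟ ℤ+ d w v ⌋ then 0 else 1)
    wrong w with P? w | f w ℤ.≟ ℤ+ d w u | f w ℤ.≟ ℤ+ d w v
    ... | no _  | _      | _      = z≤n
    ... | yes _ | no _   | _      = s≤s z≤n
    ... | yes _ | yes _  | no _   = ≤-refl
    ... | yes p | yes eq | yes eq′ = contradiction (ℤ.+-injective (trans (≡-sym eq) eq′)) (separates p)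

  d-level : ∀ {k u v i} → d u v ≡ k → i ≤ k → ∃ λ w → d w v ≡ i
  d-level {zero}  {u} eq z≤n = u , eq
  d-level {suc k} {u} eq i≤k with m≤n⇒m<n∨m≡n i≤k
  ... | inj₂ refl      = u , eq
  ... | inj₁ (s≤s i≤k) = d-level (proj₂ (proj₂ (d-step eq))) i≤k

  -- The vertices of a shortest u-v path that are closer to v than to u are separated by u and v.
  d≤errors : ∀ u v → d u v ≤ (φ u + φ v) + (φ u + φ v)
  d≤errors u v with d u v ≤? (φ u + φ v) + (φ u + φ v)
  ... | yes d≤ = d≤
  -- A distance above `E + E` leaves room for a separating vertex at each of the `E + 1` distances
  -- 0, ..., `E` from `v`, but `count-separated` allows only `E` of them.
  ... | no  d≰ = contradiction (≤-trans (near (suc E) fits) (count-separated (near? (suc E)) u v proj₁)) 1+n≰n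
    where
    E = φ u + φ v
    fits : suc E + suc E ≤ suc (d u v)
    fits = subst (_≤ suc (d u v)) (cong suc (≡-sym (+-suc E E))) (s≤s (≰⇒> d≰))
    Sep : Fin n → Set
    Sep w = d w u ≢ d w v
    near? : ∀ k → Decidable (λ w → Sep w × d w v < k)
    near? k w = ¬? (d w u ℕ.≟ d w v) ×-dec (d w v <? k)
    at? : ∀ k → Decidable (λ w → Sep w × d w v ≡ k)
    at? k w = ¬? (d w u ℕ.≟ d w v) ×-dec (d w v ℕ.≟ k)
    -- For positive `k` the hypothesis says that `k - 1`, the largest distance used, is less than
    -- half of `d u v`.
    near : ∀ k → k + k ≤ suc (d u v) → k ≤ count (near? k) (allFin n)
    near zero    _  = z≤n
    near (suc k) k≤ = begin
      suc k                                                   ≡⟨ +-comm 1 k ⟩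
      k + 1                                                   ≤⟨ +-mono-≤ (near k (m≤n⇒m≤1+n (<⇒≤ k+k<d)))
                                                                          (∈⇒1≤count {P? = at? k} (∈-allFin w) (sep , wv≡k)) ⟩
      count (near? k) (allFin n) + count (at? k) (allFin n)   ≤⟨ count-disjoint {P? = near? k} {at? k} {near? (suc k)}
                                                                    (λ (s , lt) → s , m<n⇒m<1+n lt) (λ (s , eq) → s , ≤-reflexive (cong suc eq))
                                                                    (λ (_ , lt) (_ , eq) → <-irrefl eq lt) (allFin n) ⟩
      count (near? (suc k)) (allFin n)                        ∎
      where
      open ≤-Reasoning
      k+k<d : k + k < d u v
      k+k<d = subst (_≤ d u v) (+-suc k k) (s≤s⁻¹ k≤)
      level = d-level {u = u} {v} refl (≤-trans (m≤m+n k k) (<⇒≤ k+k<d))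
      w = proj₁ level
      wv≡k = proj₂ level
      -- If `w` were at distance `k` from `u` too, the triangle inequality would give
      -- `d u v ≤ k + k`.
      sep : d w u ≢ d w v
      sep wu≡wv = contradiction (≤-trans (d-triangle u w v) (≤-reflexive (cong₂ _+_ (trans (d-sym u w) (trans wu≡wv wv≡k)) wv≡k))) (<⇒≱ k+k<d)

  d≤4*bound : ∀ {u v m} → φ u ≤ m → φ v ≤ m → d u v ≤ 4 * m
  d≤4*bound {u} {v} {m} u≤ v≤ = ≤-trans (d≤errors u v)
    (≤-trans (+-mono-≤ (+-mono-≤ u≤ v≤) (+-mono-≤ u≤ v≤)) (≤-reflexive (four m)))
    where
    four : ∀ m → (m + m) + (m + m) ≡ 4 * m
    four = solve-∀

  -- The way from the last vertex to `w` is at most the walk reversed, back to `v`, followed by a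
  -- move from `v` to `w`.
  walk-return : ∀ v w xs → walk G v (xs ++ [ w ]) ≤ walk G v xs + walk G v xs + d v w
  walk-return v w []       = ≤-reflexive (+-identityʳ (d v w))
  walk-return v w (x ∷ xs) = begin
    d v x + walk G x (xs ++ [ w ])       ≤⟨ +-monoʳ-≤ (d v x) (walk-return x w xs) ⟩
    d v x + (W + W + d x w)              ≤⟨ +-monoʳ-≤ (d v x) (+-monoʳ-≤ (W + W) (d-triangle x v w)) ⟩
    d v x + (W + W + (d x v + d v w))    ≡⟨ cong (λ z → d v x + (W + W + (z + d v w))) (d-sym x v) ⟩
    d v x + (W + W + (d v x + d v w))    ≡⟨ regroup (d v x) W (d v w) ⟩
    (d v x + W) + (d v x + W) + d v w    ∎
    where
    open ≤-Reasoning
    W = walk G x xs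
    regroup : ∀ a W c → a + (W + W + (a + c)) ≡ (a + W) + (a + W) + c
    regroup = solve-∀

  -- Cost of the doubling search

  module _ (tour : Fin n → ℕ → List (Fin n)) (B : ℕ → ℕ) (r g : Fin n)
           (B-mono : ∀ {m m′} → m ≤ m′ → B m ≤ B m′)
           (B-double : ∀ m → B m + B m ≤ B (m + m))
           (walk≤B : ∀ {m} → φ (best G f r) < m → walk G (best G f r) (tour (best G f r) m) ≤ B m)
           (visits : ∀ {m} → φ g ≤ m → g ∈ tour (best G f r) m) where

    private
      k = φ g
      v = best G f r
      Z = (B (k + k) + B (k + k)) + (B (k + k) + B (k + k))

    -- A round with `m < k` costs at most `B m + B m`, including the way back. The same amount is
    -- held as slack; cost and slack together are at most `B (m + m) + B (m + m)`, the slack of the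
    -- next round, so the geometric sum stays below `Z`. Only bounds below `k` are doubled, which
    -- preserves `m ≤ k + k`.
    doubling-finds : ∀ fuel {m} → φ v < m → m ≤ k + k → k ≤ fuel + m →
                     ∃ λ b → Finds G g v (doubling G (tour v) v fuel m) b × b + (B m + B m) ≤ Z
    doubling-finds zero {m} v<m m≤2k k≤m =
      walk G v (tour v m) ,
      subst (λ xs → Finds G g v xs (walk G v (tour v m))) (++-identityʳ (tour v m)) (finds-∈ G (visits k≤m)) ,
      +-mono-≤ (≤-trans (walk≤B v<m) (≤-trans (B-mono m≤2k) (m≤m+n _ _))) (+-mono-≤ (B-mono m≤2k) (B-mono m≤2k))
    doubling-finds (suc fuel) {m} v<m m≤2k k≤ with k ≤? m
    ... | yes k≤m = walk G v (tour v m) , finds-∈ G (visits k≤m) ,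
      +-mono-≤ (≤-trans (walk≤B v<m) (≤-trans (B-mono m≤2k) (m≤m+n _ _))) (+-mono-≤ (B-mono m≤2k) (B-mono m≤2k))
    ... | no  k≰m with doubling-finds fuel {m + m} (m≤n⇒m≤n+o m v<m) (+-mono-≤ (≰⇒≥ k≰m) (≰⇒≥ k≰m)) fuel-enough
      where
      -- `m` is positive, so doubling it makes up for the unit of fuel spent.
      fuel-enough : k ≤ fuel + (m + m)
      fuel-enough = ≤-trans k≤ (≤-trans (≤-reflexive (≡-sym (+-suc fuel m)))
        (+-monoʳ-≤ fuel (+-monoˡ-≤ m (≤-trans (s≤s z≤n) v<m))))
    ... | b , found , b≤ = (B m + B m) + b , finds-mono G (+-monoˡ-≤ b there-and-back) (finds-++ G (tour v m) found) ,
      ≤-trans (≤-reflexive (+-comm (B m + B m + b) (B m + B m)))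
        (≤-trans (≤-reflexive (regroup (B m) b)) (≤-trans (+-monoʳ-≤ b (+-mono-≤ (B-double m) (B-double m))) b≤))
      where
      regroup : ∀ B b → (B + B) + ((B + B) + b) ≡ b + ((B + B) + (B + B))
      regroup = solve-∀
      there-and-back : walk G v (tour v m ++ [ v ]) ≤ B m + B m
      there-and-back = ≤-trans (walk-return v v (tour v m))
        (≤-trans (≤-reflexive (trans (cong (walk G v (tour v m) + walk G v (tour v m) +_) (d-refl v)) (+-identityʳ _)))
          (+-mono-≤ (walk≤B v<m) (walk≤B v<m)))

    plan-finds : Finds G g r (plan G f tour r) (d r g + (4 * k + 4 * B (k + k)))
    plan-finds with k ℕ.≟ 0
    -- Then `φ v` is 0 as well, and `d≤4*bound` puts `v` at distance 0 from `g`: the first visit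
    -- ends the search.
    ... | yes k≡0 = subst (λ x → Finds G g r (x ∷ doubling G (tour v) v n (suc (φ v))) (d r g + (4 * k + 4 * B (k + k)))) (≡-sym v≡g)
      (finds-mono G (+-monoʳ-≤ (d r g) z≤n) (finds-step G {v = r} {b = 0} (finds-here G (doubling G (tour v) v n (suc (φ v))))))
      where
      v≡g : v ≡ g
      v≡g = d≡0⇒≡ (n≤0⇒n≡0 (subst (λ j → d v g ≤ 4 * j) k≡0 (d≤4*bound (best-least G f r g) ≤-refl)))
    -- For positive `k` the first bound `suc (φ v)` is at most `k + k`.
    ... | no  k≢0 with doubling-finds n {suc (φ v)} ≤-refl (+-mono-≤ (n≢0⇒n>0 k≢0) (best-least G f r g))
                         (≤-trans (errors≤n g) (m≤m+n n _))
    ... | b , found , b≤ = finds-mono G bound (finds-step G {v = r} found)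
      where
      open ≤-Reasoning
      four : ∀ x → (x + x) + (x + x) ≡ 4 * x
      four = solve-∀
      bound : d r v + b ≤ d r g + (4 * k + 4 * B (k + k))
      bound = begin
        d r v + b                              ≤⟨ +-mono-≤ (d-triangle r g v) (m+n≤o⇒m≤o b b≤) ⟩
        (d r g + d g v) + Z                    ≤⟨ +-mono-≤ (+-monoʳ-≤ (d r g) (d≤4*bound ≤-refl (best-least G f r g))) (≤-reflexive (four (B (k + k)))) ⟩
        (d r g + 4 * k) + 4 * B (k + k)        ≡⟨ +-assoc (d r g) (4 * k) _ ⟩
        d r g + (4 * k + 4 * B (k + k))        ∎

-- Doubling metrics

module _ {n : ℕ} (G : Graph n) {α : ℕ} (doubling : Doubling G α) where

  -- Each round replaces every ball by at most `2 ^ α` balls of half the radius. Halving rounds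
  -- down, hence the inequality `ρ * 2 ^ t ≤ R`.
  iterated-cover : ∀ t x R → Σ (List (Fin n)) λ cs → Σ ℕ λ ρ →
                   length cs ≤ (2 ^ α) ^ t × ρ * 2 ^ t ≤ R ×
                   (∀ {v} → dist G x v ≤ R → ∃ λ c → c ∈ cs × dist G c v ≤ ρ)
  iterated-cover zero x R = x ∷ [] , R , ≤-refl , ≤-reflexive (*-identityʳ R) , λ xv≤ → x , here refl , xv≤
  iterated-cover (suc t) x R with iterated-cover t x R
  ... | cs , ρ , cs≤ , ρ≤ , cover =
    concatMap centres cs , ρ / 2 ,
    ≤-trans (length-concatMap-≤ centres (λ c → proj₁ (proj₂ (doubling c ρ))) cs)
      (≤-trans (*-monoˡ-≤ (2 ^ α) cs≤) (≤-reflexive (*-comm _ (2 ^ α)))) ,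
    ≤-trans (≤-reflexive (≡-sym (*-assoc (ρ / 2) 2 (2 ^ t)))) (≤-trans (*-monoˡ-≤ (2 ^ t) (m/n*n≤m ρ 2)) ρ≤) ,
    refined
    where
    centres : Fin n → List (Fin n)
    centres c = proj₁ (doubling c ρ)
    refined : ∀ {v} → dist G x v ≤ R → ∃ λ c → c ∈ concatMap centres cs × dist G c v ≤ ρ / 2
    refined {v} xv≤ with cover xv≤
    ... | c , c∈cs , cv≤ with find (proj₂ (proj₂ (doubling c ρ)) v cv≤)
    ...   | c′ , c′∈ , c′v≤ = c′ , ∈-concatMap⁺ centres (lose c∈cs c′∈) , c′v≤

module _ {n : ℕ} (G : Graph n) where

  walk≤length : ∀ {P : Fin n → Set} {b} → (∀ {u w} → P u → P w → dist G u w ≤ b) →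
                ∀ {v xs} → P v → All P xs → walk G v xs ≤ length xs * b
  walk≤length close pv []         = z≤n
  walk≤length close pv (px ∷ pxs) = +-mono-≤ (close pv px) (walk≤length close px pxs)

  candidate? : ∀ (f : Fin n → ℤ) m → Decidable (λ v → errors G f v ≤ m)
  candidate? f m v = errors G f v ≤? m

  candidates : (Fin n → ℤ) → ℕ → List (Fin n)
  candidates f m = filter (candidate? f m) (allFin n)

-- Number of candidates in a doubling metric

module DoublingTour {n : ℕ} (G : Graph n) (connected : Connected G) (f : Fin n → ℤ)
                    {α : ℕ} (doubling : Doubling G α) where

  open Metric G connected
  open Prediction G connected f

  private
    d : Fin n → Fin n → ℕ
    d = dist G
    φ : Fin n → ℕ
    φ = errors G f

  module _ {m : ℕ} {p : Fin n} (p-cand : φ p ≤ m) where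

    private
      q : Fin n
      q = argmax (d p) p (candidates G f m)
      R : ℕ
      R = d p q

    q-cand : φ q ≤ m
    q-cand = argmax-all (d p) p-cand (all-filter (candidate? G f m) (allFin n))

    within-R : ∀ {v} → φ v ≤ m → d p v ≤ R
    within-R {v} v-cand = All.lookup (f[xs]≤f[argmax] p (candidates G f m)) (∈-filter⁺ (candidate? G f m) (∈-allFin v) v-cand)

    -- Either p or q is at distance at least R / 2 from x, and separates x from all vertices close to x.
    count-ball : 0 < R → ∀ {ρ} → ρ * 16 ≤ R → ∀ c →
                 count (λ v → candidate? G f m v ×-dec (d c v ≤? ρ)) (allFin n) ≤ m + m
    count-ball 0<R {ρ} ρ≤ c = count-inhabited near? far
      where
      near? : Decidable (λ v → φ v ≤ m × d c v ≤ ρ)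
      near? v = candidate? G f m v ×-dec (d c v ≤? ρ)

      separated-by : ∀ {x y} → φ x ≤ m → d c x ≤ ρ → φ y ≤ m → R ≤ d x y + d x y → count near? (allFin n) ≤ m + m
      separated-by {x} {y} x-cand cx≤ y-cand R≤ =
        ≤-trans (count-separated near? x y λ (_ , cw≤) → separates cw≤) (+-mono-≤ x-cand y-cand)
        where
        separates : ∀ {w} → d c w ≤ ρ → d w x ≢ d w y
        -- Equidistance gives `d x y ≤ d x w + d w y ≤ 4 * ρ`, so `R ≤ 8 * ρ`. Twice this is
        -- `2 * R ≤ 16 * ρ ≤ R`, impossible for positive `R`; this is where the 16 comes from.
        separates {w} cw≤ wx≡wy = contradiction (+-cancelˡ-≤ R R 0 2R≤R) (<⇒≱ 0<R)
          where
          open ≤-Reasoning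
          wx≤ : d w x ≤ ρ + ρ
          wx≤ = ≤-trans (d-triangle w c x) (+-mono-≤ (≤-trans (≤-reflexive (d-sym w c)) cw≤) cx≤)
          xy≤ : d x y ≤ (ρ + ρ) + (ρ + ρ)
          xy≤ = ≤-trans (d-triangle x w y)
            (+-mono-≤ (≤-trans (≤-reflexive (d-sym x w)) wx≤) (≤-trans (≤-reflexive (≡-sym wx≡wy)) wx≤))
          sixteen : ∀ ρ → let xy = (ρ + ρ) + (ρ + ρ) in (xy + xy) + (xy + xy) ≡ ρ * 16
          sixteen = solve-∀
          2R≤R : R + R ≤ R + 0
          2R≤R = begin
            R + R                             ≤⟨ +-mono-≤ R≤ R≤ ⟩
            (d x y + d x y) + (d x y + d x y) ≤⟨ +-mono-≤ (+-mono-≤ xy≤ xy≤) (+-mono-≤ xy≤ xy≤) ⟩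
            _                                 ≡⟨ sixteen ρ ⟩
            ρ * 16                            ≤⟨ ρ≤ ⟩
            R                                 ≡⟨ +-identityʳ R ⟨
            R + 0                             ∎

      far : ∀ {x} → φ x ≤ m × d c x ≤ ρ → count near? (allFin n) ≤ m + m
      far {x} (x-cand , cx≤) with ≤-total (d x p) (d x q)
      ... | inj₁ xp≤xq = separated-by x-cand cx≤ q-cand
        (≤-trans (d-triangle p x q) (+-monoˡ-≤ (d x q) (≤-trans (≤-reflexive (d-sym p x)) xp≤xq)))
      ... | inj₂ xq≤xp = separated-by x-cand cx≤ p-cand
        (≤-trans (d-triangle p x q) (+-mono-≤ (≤-reflexive (d-sym p x)) xq≤xp))

    length-candidates : 0 < R → length (candidates G f m) ≤ (2 ^ α) ^ 4 * (m + m)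
    -- Four halvings bring the radius down to `R / 16`, as `count-ball` requires.
    length-candidates 0<R with iterated-cover G {α} doubling 4 p R
    ... | cs , ρ , cs≤ , ρ≤ , cover = begin
      length (candidates G f m)                           ≡⟨ length-filter≡count (candidate? G f m) (allFin n) ⟩
      count (candidate? G f m) (allFin n)                 ≤⟨ count-cover {P? = candidate? G f m} {near?} cs (allFin n)
                                                               (λ v-cand → let c , c∈cs , cv≤ = cover (within-R v-cand) in c , c∈cs , v-cand , cv≤) ⟩
      sum (map (λ c → count (near? c) (allFin n)) cs)     ≤⟨ sum-mono (count-ball 0<R ρ≤) cs ⟩
      sum (map (λ _ → m + m) cs)                          ≡⟨ sum-const (m + m) cs ⟩
      length cs * (m + m)                                 ≤⟨ *-monoˡ-≤ (m + m) cs≤ ⟩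
      (2 ^ α) ^ 4 * (m + m)                               ∎
      where
      open ≤-Reasoning
      near? : ∀ c → Decidable (λ v → φ v ≤ m × d c v ≤ ρ)
      near? c v = candidate? G f m v ×-dec (d c v ≤? ρ)

    walk-candidates : walk G p (candidates G f m) ≤ 8 * (2 ^ α) ^ 4 * (m * m)
    walk-candidates with R ℕ.≟ 0
    -- All candidates coincide with `p`, so every move between them is free.
    ... | yes R≡0 = ≤-trans (walk≤length G together p-cand cands) (≤-trans (≤-reflexive (*-zeroʳ (length (candidates G f m)))) z≤n)
      where
      cands = all-filter (candidate? G f m) (allFin n)
      together : ∀ {u w} → φ u ≤ m → φ w ≤ m → d u w ≤ 0
      together {u} {w} u-cand w-cand = ≤-trans (d-triangle u p w)
        (+-mono-≤ (≤-trans (≤-reflexive (d-sym u p)) (≤-trans (within-R u-cand) (≤-reflexive R≡0)))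
                  (≤-trans (within-R w-cand) (≤-reflexive R≡0)))
    ... | no  R≢0 = begin
      walk G p (candidates G f m)             ≤⟨ walk≤length G d≤4*bound p-cand (all-filter (candidate? G f m) (allFin n)) ⟩
      length (candidates G f m) * (4 * m)     ≤⟨ *-monoˡ-≤ (4 * m) (length-candidates (n≢0⇒n>0 R≢0)) ⟩
      (2 ^ α) ^ 4 * (m + m) * (4 * m)         ≡⟨ regroup ((2 ^ α) ^ 4) m ⟩
      8 * (2 ^ α) ^ 4 * (m * m)               ∎
      where
      open ≤-Reasoning
      regroup : ∀ A m → A * (m + m) * (4 * m) ≡ 8 * A * (m * m)
      regroup = solve-∀

doubling-plan : Algorithm
doubling-plan n G r f = plan G f (λ _ → candidates G f) r

doubling-plan-cost : ∀ n (G : Graph n) (r : Fin n) (f : Fin n → ℤ) (g : Fin n) α → Connected G → IsDoublingDim G α →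
                     CostAtMost doubling-plan n G r f g
                       (dist G r g + 132 * 2 ^ (4 * α) * (errors G f g * errors G f g))
doubling-plan-cost n G r f g α connected (doubling , _) =
  Finds.found-at-cost (finds-mono G bound (plan-finds (λ _ → candidates G f) (λ m → K * (m * m)) r g
    (λ m≤m′ → *-monoʳ-≤ K (*-mono-≤ m≤m′ m≤m′)) K-double
    (λ {m} v<m → walk-candidates {m} (<⇒≤ v<m))
    (λ {m} g-cand → ∈-filter⁺ (candidate? G f m) (∈-allFin g) g-cand)))
  where
  open Prediction G connected f
  open DoublingTour G connected f {α} doubling
  A K k : ℕ
  A = (2 ^ α) ^ 4
  K = 8 * A
  k = errors G f g
  K-double : ∀ m → K * (m * m) + K * (m * m) ≤ K * ((m + m) * (m + m))
  K-double m = ≤-trans (m≤m+n _ (K * (m * m) + K * (m * m))) (≤-reflexive (regroup K m))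
    where
    regroup : ∀ K m → (K * (m * m) + K * (m * m)) + (K * (m * m) + K * (m * m)) ≡ K * ((m + m) * (m + m))
    regroup = solve-∀
  k≤k*k : ∀ k → k ≤ k * k
  k≤k*k zero    = z≤n
  k≤k*k (suc k) = m≤m*n (suc k) (suc k)
  1≤A : 1 ≤ A
  1≤A = m^n>0 (2 ^ α) {{m^n≢0 2 α}} 4
  -- With `B m = 8 * A * m²` the total is `4 * k + 4 * B (2 * k)`; 132 is 4 from the first term,
  -- after `k ≤ A * k²`, plus `4 * 8 * 4` from the second.
  bound : dist G r g + (4 * k + 4 * (K * ((k + k) * (k + k)))) ≤ dist G r g + 132 * 2 ^ (4 * α) * (k * k)
  bound = +-monoʳ-≤ (dist G r g) (begin
    4 * k + 4 * (K * ((k + k) * (k + k)))                   ≤⟨ +-monoˡ-≤ _ (*-monoʳ-≤ 4 (≤-trans (k≤k*k k)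
                                                                  (≤-trans (≤-reflexive (≡-sym (*-identityˡ (k * k)))) (*-monoˡ-≤ (k * k) 1≤A)))) ⟩
    4 * (A * (k * k)) + 4 * (8 * A * ((k + k) * (k + k)))   ≡⟨ regroup A k ⟩
    132 * A * (k * k)                                       ≡⟨ cong (λ x → 132 * x * (k * k)) (trans (^-*-assoc 2 α 4) (cong (2 ^_) (*-comm α 4))) ⟩
    132 * 2 ^ (4 * α) * (k * k)                             ∎)
    where
    open ≤-Reasoning
    regroup : ∀ A k → 4 * (A * (k * k)) + 4 * (8 * A * ((k + k) * (k + k))) ≡ 132 * A * (k * k)
    regroup = solve-∀

-- Trees

module _ {n : ℕ} (G : Graph n) where

  data Path : Fin n → Fin n → List (Fin n) → Set where
    stop : ∀ {v} → Path v v (v ∷ [])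
    step : ∀ {u v w xs} → Adj G u w → Path w v xs → Path u v (u ∷ xs)

  path-++ : ∀ {u v x y xs ys} → Path u x xs → Adj G x y → Path y v ys → Path u v (xs ++ ys)
  path-++ stop        xy q = step xy q
  path-++ (step uw p) xy q = step uw (path-++ p xy q)

  path⇒chain : ∀ {u v xs} → Path u v xs → Chain G xs
  path⇒chain stop                    = tt
  path⇒chain (step uv stop)          = uv , tt
  path⇒chain (step uw p@(step _ _)) = uw , path⇒chain p

  1≤length-path : ∀ {u v xs} → Path u v xs → 1 ≤ length xs
  1≤length-path stop       = ≤-refl
  1≤length-path (step _ _) = s≤s z≤n

  2≤length-path : ∀ {u v xs} → u ≢ v → Path u v xs → 2 ≤ length xs
  2≤length-path u≢u stop       = contradiction refl u≢u
  2≤length-path u≢v (step _ p) = s≤s (1≤length-path p)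

  closed-path⇒cycle : ∀ {u v xs} → Path u v xs → Adj G v u → Unique xs → 3 ≤ length xs → HasCycle G
  closed-path⇒cycle stop         _  _  (s≤s ())
  closed-path⇒cycle (step {u} {xs = xs} uw p) vu xs! (s≤s 2≤) =
    u , xs , 2≤ , xs! , path⇒chain (path-++ (step uw p) vu stop)

-- Branches of a tree

module Tree {n : ℕ} (G : Graph n) (connected : Connected G) (acyclic : ¬ HasCycle G) where

  open Metric G connected

  private
    d : Fin n → Fin n → ℕ
    d = dist G

  -- `P` is any property preserved by steps towards `t`. The vertices are distinct because their
  -- distances to `t` strictly decrease; the last component carries this through the induction.
  geodesic : {P : Fin n → Set} (t : Fin n) → (∀ {z z′} → P z → Adj G z z′ → d z t ≡ suc (d z′ t) → P z′) →
             ∀ k {u} → d u t ≡ k → P u →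
             ∃ λ xs → Path G u t xs × All P xs × Unique xs × All (λ z → d z t ≤ k) xs
  geodesic t descend zero {u} eq pu with refl ← d≡0⇒≡ eq =
    u ∷ [] , stop , pu ∷ [] , [] ∷ [] , ≤-reflexive eq ∷ []
  geodesic t descend (suc k) {u} eq pu with d-step eq
  ... | w , uw , wt≡k with geodesic t descend k wt≡k (descend pu uw (trans eq (cong suc (≡-sym wt≡k))))
  ...   | xs , path , pxs , xs! , xs≤ =
    u ∷ xs , step uw path , pu ∷ pxs ,
    All.map (λ {z} z≤ u≡z → contradiction (≤-trans (≤-reflexive (trans (≡-sym eq) (cong (λ y → d y t) u≡z))) z≤) 1+n≰n) xs≤ ∷ xs! ,
    ≤-reflexive eq ∷ All.map m≤n⇒m≤1+n xs≤

  module _ {c b : Fin n} (cb : Adj G c b) where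

    -- The branch behind the edge `cb`, in metric form: the vertices closer to `b` than to `c`.
    Beyond : Fin n → Set
    Beyond w = d c w ≡ suc (d b w)

    beyond? : Decidable Beyond
    beyond? w = d c w ℕ.≟ suc (d b w)

    beyond : ∀ {w} → suc (d b w) ≤ d c w → Beyond w
    beyond {w} = ≤-antisym (d-adj-≤ w cb)

    -- Shortest paths b ⇝ x inside Beyond and y ⇝ c outside it close up with the edges xy and cb to a cycle.
    crossing-edge : ∀ {x y} → Adj G x y → Beyond x → ¬ Beyond y → x ≡ b × y ≡ c
    crossing-edge {x} {y} xy bx ¬by = cases (x ≟ b) (y ≟ c)
      where
      Between : Fin n → Set
      -- `z` lies on a shortest path from `b` to `x`; all such `z` are in the branch because `x` is.
      Between z = d b z + d z x ≡ d b x
      Between-descend : ∀ {z z′} → Between z → Adj G z z′ → d z x ≡ suc (d z′ x) → Between z′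
      Between-descend {z} {z′} bz zz′ eq = ≤-antisym (begin
        d b z′ + d z′ x              ≤⟨ +-monoˡ-≤ (d z′ x) (≤-trans (d-triangle b z z′) (+-monoʳ-≤ (d b z) (d-adj zz′))) ⟩
        d b z + 1 + d z′ x           ≡⟨ +-assoc (d b z) 1 _ ⟩
        d b z + suc (d z′ x)         ≡⟨ cong (d b z +_) eq ⟨
        d b z + d z x                ≡⟨ bz ⟩
        d b x                        ∎) (d-triangle b z′ x)
        where open ≤-Reasoning
      Between⇒Beyond : ∀ {z} → Between z → Beyond z
      Between⇒Beyond {z} bz = beyond (+-cancelʳ-≤ (d z x) _ _ (begin
        suc (d b z + d z x)          ≡⟨ cong suc bz ⟩
        suc (d b x)                  ≡⟨ bx ⟨
        d c x                        ≤⟨ d-triangle c z x ⟩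
        d c z + d z x                ∎))
        where open ≤-Reasoning
      ¬Beyond-descend : ∀ {z z′} → ¬ Beyond z → Adj G z z′ → d z c ≡ suc (d z′ c) → ¬ Beyond z′
      ¬Beyond-descend {z} {z′} ¬bz zz′ eq bz′ = ¬bz (beyond (begin
        suc (d b z)                  ≡⟨ cong suc (d-sym b z) ⟩
        suc (d z b)                  ≤⟨ s≤s (d-adj-≤ b zz′) ⟩
        suc (suc (d z′ b))           ≡⟨ cong (λ j → suc (suc j)) (d-sym z′ b) ⟩
        suc (suc (d b z′))           ≡⟨ cong suc bz′ ⟨
        suc (d c z′)                 ≡⟨ cong suc (d-sym c z′) ⟩
        suc (d z′ c)                 ≡⟨ eq ⟨
        d z c                        ≡⟨ d-sym z c ⟩
        d c z                        ∎))
        where open ≤-Reasoning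
      bx-geodesic = geodesic x Between-descend (d b x) refl (cong (_+ d b x) (d-refl b))
      yc-geodesic = geodesic c ¬Beyond-descend (d y c) refl ¬by
      ps = proj₁ bx-geodesic
      qs = proj₁ yc-geodesic
      path-bx = proj₁ (proj₂ bx-geodesic)
      path-yc = proj₁ (proj₂ yc-geodesic)
      unique : Unique (ps ++ qs)
      unique = Unique.++⁺ (proj₁ (proj₂ (proj₂ (proj₂ bx-geodesic)))) (proj₁ (proj₂ (proj₂ (proj₂ yc-geodesic))))
        λ (z∈ps , z∈qs) → All.lookup (proj₁ (proj₂ (proj₂ yc-geodesic))) z∈qs
                            (Between⇒Beyond (All.lookup (proj₁ (proj₂ (proj₂ bx-geodesic))) z∈ps))
      -- The two disjoint paths close up to a cycle once they have three vertices together; with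
      -- only two, both are trivial, that is, `x ≡ b` and `y ≡ c`.
      not-long : ¬ 3 ≤ length ps + length qs
      not-long 3≤ = acyclic (closed-path⇒cycle G (path-++ G path-bx xy path-yc) cb unique
        (≤-trans 3≤ (≤-reflexive (≡-sym (length-++ ps)))))
      cases : Dec (x ≡ b) → Dec (y ≡ c) → x ≡ b × y ≡ c
      cases (yes x≡b) (yes y≡c) = x≡b , y≡c
      cases (no x≢b)  _         = contradiction
        (+-mono-≤ (2≤length-path G (λ b≡x → x≢b (≡-sym b≡x)) path-bx) (1≤length-path G path-yc)) not-long
      cases (yes _)   (no y≢c)  = contradiction
        (+-mono-≤ (1≤length-path G path-bx) (2≤length-path G y≢c path-yc)) not-long

    -- A shortest path from `w` to `u` leaves the branch somewhere, by `crossing-edge` along the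
    -- edge from `b` to `c`; hence it passes through `c`.
    beyond-separated : ∀ {w u} → Beyond w → ¬ Beyond u → d w c + d c u ≤ d w u
    beyond-separated {w} {u} bw ¬bu = go (d w u) refl bw
      where
      go : ∀ k {w} → d w u ≡ k → Beyond w → d w c + d c u ≤ k
      go zero    eq bw = contradiction (subst Beyond (d≡0⇒≡ eq) bw) ¬bu
      go (suc k) {w} eq bw with d-step eq
      ... | w′ , ww′ , eq′ with beyond? w′
      ...   | yes bw′ = ≤-trans (+-monoˡ-≤ (d c u) (d-adj-≤ c ww′)) (s≤s (go k eq′ bw′))
      ...   | no ¬bw′ with crossing-edge ww′ bw ¬bw′
      ...     | refl , refl = +-mono-≤ (d-adj ww′) (≤-reflexive eq′)

-- Touring the union of shortest paths

module _ {n : ℕ} (G : Graph n) where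

  -- Hangs `w` as a leaf on its first neighbour in the list; inserted one by one, the vertices yield
  -- a walk around the tree.
  insertAfter : Fin n → List (Fin n) → List (Fin n)
  insertAfter w []       = []
  insertAfter w (x ∷ xs) = if adj G x w then x ∷ w ∷ xs else x ∷ insertAfter w xs

  grow : {P : Fin n → Set} → Decidable P → List (Fin n) → List (Fin n) → List (Fin n)
  grow P? ws xs = foldr (λ w ys → if does (P? w) then insertAfter w ys else ys) xs ws

  module _ (f : Fin n → ℤ) (m : ℕ) where

    radius : Fin n → ℕ
    radius v = foldr _⊔_ 0 (map (dist G v) (candidates G f m))

    abstract
      centre : Fin n → Fin n
      centre v = argmin radius v (allFin n)

      centre-least : ∀ v u → radius (centre v) ≤ radius u
      centre-least v u = All.lookup (f[argmin]≤f[xs] v (allFin n)) (∈-allFin u)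

    -- The union of the shortest paths from `c` to the candidates.
    Spanned : Fin n → Fin n → Set
    Spanned c w = ∃ λ s → errors G f s ≤ m × dist G c w + dist G w s ≡ dist G c s

    spanned? : ∀ c → Decidable (Spanned c)
    spanned? c w = any? λ s → candidate? G f m s ×-dec (dist G c w + dist G w s ℕ.≟ dist G c s)

    layer? : ∀ c i → Decidable (λ w → Spanned c w × dist G c w ≡ i)
    layer? c i w = spanned? c w ×-dec (dist G c w ℕ.≟ i)

    -- Insertion by increasing distance from `c`, so that a neighbour of each new vertex is already
    -- in the list.
    layers : Fin n → ℕ → List (Fin n)
    layers c zero    = c ∷ []
    layers c (suc i) = grow (layer? c (suc i)) (allFin n) (layers c i)

    spanning-tour : Fin n → List (Fin n)
    spanning-tour v = layers (centre v) n

  ∈-insertAfter⁺ : ∀ {w y} xs → y ∈ xs → y ∈ insertAfter w xs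
  ∈-insertAfter⁺ {w} (x ∷ xs) y∈ with adj G x w | y∈
  ... | true  | here refl  = here refl
  ... | true  | there y∈xs = there (there y∈xs)
  ... | false | here refl  = here refl
  ... | false | there y∈xs = there (∈-insertAfter⁺ xs y∈xs)

  ∈-insertAfter : ∀ {w x} xs → x ∈ xs → Adj G x w → w ∈ insertAfter w xs
  ∈-insertAfter {w} (y ∷ xs) x∈ xw with adj G y w in eq | x∈
  ... | true  | _          = there (here refl)
  ... | false | here refl  = contradiction (trans (≡-sym eq) xw) λ ()
  ... | false | there x∈xs = there (∈-insertAfter xs x∈xs xw)

  module _ {P : Fin n → Set} (P? : Decidable P) where

    ∈-grow⁺ : ∀ {y xs} ws → y ∈ xs → y ∈ grow P? ws xs
    ∈-grow⁺ []       y∈ = y∈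
    ∈-grow⁺ (w ∷ ws) y∈ with P? w
    ... | yes _ = ∈-insertAfter⁺ _ (∈-grow⁺ ws y∈)
    ... | no  _ = ∈-grow⁺ ws y∈

    ∈-grow : ∀ {w x xs ws} → w ∈ ws → P w → x ∈ xs → Adj G x w → w ∈ grow P? ws xs
    ∈-grow {w} {ws = _ ∷ ws} (here refl) pw x∈ xw with P? w
    ... | yes _  = ∈-insertAfter _ (∈-grow⁺ ws x∈) xw
    ... | no ¬pw = contradiction pw ¬pw
    ∈-grow {ws = y ∷ _} (there w∈) pw x∈ xw with P? y
    ... | yes _ = ∈-insertAfter⁺ _ (∈-grow w∈ pw x∈ xw)
    ... | no  _ = ∈-grow w∈ pw x∈ xw

module SpanningTour {n : ℕ} (G : Graph n) (connected : Connected G) (f : Fin n → ℤ) where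

  open Metric G connected
  open Prediction G connected f

  private
    d : Fin n → Fin n → ℕ
    d = dist G
    φ : Fin n → ℕ
    φ = errors G f

  -- The agent steps from `x` to `w`, and from `w` the next vertex is at most 1 farther than from
  -- `x`.
  walk-insertAfter : ∀ {v w} xs → walk G v (insertAfter G w xs) ≤ walk G v xs + 2
  walk-insertAfter [] = z≤n
  walk-insertAfter {v} {w} (x ∷ xs) with adj G x w in xw
  ... | false = ≤-trans (+-monoʳ-≤ (d v x) (walk-insertAfter xs)) (≤-reflexive (≡-sym (+-assoc (d v x) _ 2)))
  ... | true  = begin
    d v x + (d x w + walk G w xs)   ≤⟨ +-monoʳ-≤ (d v x) (+-mono-≤ (d-adj xw) (detour xs)) ⟩
    d v x + (1 + (1 + walk G x xs)) ≡⟨ regroup (d v x) (walk G x xs) ⟩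
    d v x + walk G x xs + 2         ∎
    where
    open ≤-Reasoning
    regroup : ∀ a W → a + (1 + (1 + W)) ≡ a + W + 2
    regroup = solve-∀
    detour : ∀ ys → walk G w ys ≤ 1 + walk G x ys
    detour []       = z≤n
    detour (y ∷ ys) = +-monoˡ-≤ (walk G y ys) (d-adj-≤ y (Adj-sym G xw))

  walk-grow : ∀ {P : Fin n → Set} (P? : Decidable P) {v xs} ws →
              walk G v (grow G P? ws xs) ≤ walk G v xs + count P? ws * 2
  walk-grow P? []       = m≤m+n _ _
  walk-grow P? {v} {xs} (w ∷ ws) with P? w
  ... | no  _ = walk-grow P? ws
  ... | yes _ = begin
    walk G v (insertAfter G w (grow G P? ws xs)) ≤⟨ walk-insertAfter (grow G P? ws xs) ⟩
    walk G v (grow G P? ws xs) + 2               ≤⟨ +-monoˡ-≤ 2 (walk-grow P? ws) ⟩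
    walk G v xs + count P? ws * 2 + 2            ≡⟨ regroup (walk G v xs) (count P? ws) ⟩
    walk G v xs + suc (count P? ws) * 2          ∎
    where
    open ≤-Reasoning
    regroup : ∀ W k → W + k * 2 + 2 ≡ W + suc k * 2
    regroup = solve-∀

  module _ (m : ℕ) (c : Fin n) where

    -- Leaves out `c`, whose visit is paid for by `d v c`; every other vertex of the tour costs 2.
    inner? : ∀ i → Decidable (λ w → Spanned G f m c w × 0 < d c w × d c w ≤ i)
    inner? i w = spanned? G f m c w ×-dec ((0 <? d c w) ×-dec (d c w ≤? i))

    walk-layers : ∀ v i → walk G v (layers G f m c i) ≤ d v c + count (inner? i) (allFin n) * 2
    walk-layers v zero    = +-monoʳ-≤ (d v c) z≤n
    walk-layers v (suc i) = begin
      walk G v (layers G f m c (suc i))      ≤⟨ walk-grow (layer? G f m c (suc i)) (allFin n) ⟩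
      walk G v (layers G f m c i) + new * 2  ≤⟨ +-monoˡ-≤ (new * 2) (walk-layers v i) ⟩
      d v c + old * 2 + new * 2              ≡⟨ +-assoc (d v c) (old * 2) (new * 2) ⟩
      d v c + (old * 2 + new * 2)            ≡⟨ cong (d v c +_) (*-distribʳ-+ 2 old new) ⟨
      d v c + (old + new) * 2                ≤⟨ +-monoʳ-≤ (d v c) (*-monoˡ-≤ 2 (count-disjoint {P? = inner? i} {layer? G f m c (suc i)} {inner? (suc i)}
                                                  (λ (sp , pos , le) → sp , pos , m≤n⇒m≤1+n le)
                                                  (λ (sp , eq) → sp , ≤-trans (s≤s z≤n) (≤-reflexive (≡-sym eq)) , ≤-reflexive eq)
                                                  (λ (_ , _ , le) (_ , eq) → contradiction (≤-trans (≤-reflexive (≡-sym eq)) le) 1+n≰n) (allFin n))) ⟩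
      d v c + count (inner? (suc i)) (allFin n) * 2 ∎
      where
      open ≤-Reasoning
      old = count (inner? i) (allFin n)
      new = count (layer? G f m c (suc i)) (allFin n)

    -- The neighbour of `w` towards `c` lies on a shortest path to the same candidate `s`.
    spanned-parent : ∀ {w i} → Spanned G f m c w → d c w ≡ suc i → ∃ λ x → Adj G x w × Spanned G f m c x × d c x ≡ i
    spanned-parent {w} {i} (s , s-cand , cws) eq with d-step (trans (d-sym w c) eq)
    ... | x , wx , xc≡i = x , Adj-sym G wx , (s , s-cand , ≤-antisym shortest (d-triangle c x s)) , cx≡i
      where
      open ≤-Reasoning
      cx≡i = trans (d-sym c x) xc≡i
      shortest : d c x + d x s ≤ d c s
      shortest = begin
        d c x + d x s       ≤⟨ +-mono-≤ (≤-reflexive cx≡i) (d-adj-≤ s (Adj-sym G wx)) ⟩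
        i + suc (d w s)     ≡⟨ +-suc i (d w s) ⟩
        suc i + d w s       ≡⟨ cong (_+ d w s) eq ⟨
        d c w + d w s       ≡⟨ cws ⟩
        d c s               ∎

    ∈-layers : ∀ i {w} → Spanned G f m c w → d c w ≤ i → w ∈ layers G f m c i
    ∈-layers zero    sp cw≤ = here (≡-sym (d≡0⇒≡ (n≤0⇒n≡0 cw≤)))
    ∈-layers (suc i) {w} sp cw≤ with m≤n⇒m<n∨m≡n cw≤
    ... | inj₁ (s≤s cw≤i) = ∈-grow⁺ G (layer? G f m c (suc i)) (allFin n) (∈-layers i sp cw≤i)
    ... | inj₂ cw≡1+i with spanned-parent sp cw≡1+i
    ...   | x , xw , spx , cx≡i = ∈-grow G (layer? G f m c (suc i)) (∈-allFin w) (sp , cw≡1+i)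
                                    (∈-layers i spx (≤-reflexive cx≡i)) xw

  dist≤radius : ∀ {m u} v → φ u ≤ m → d v u ≤ radius G f m v
  dist≤radius {m} {u} v u-cand = ≤-foldr-⊔ (d v) (∈-filter⁺ (candidate? G f m) (∈-allFin u) u-cand)

  candidate-∈-tour : ∀ {m g} v → φ g ≤ m → g ∈ spanning-tour G f m v
  candidate-∈-tour {m} {g} v g-cand = ∈-layers m c n
    (g , g-cand , trans (cong (d c g +_) (d-refl g)) (+-identityʳ (d c g))) (d≤n c g)
    where c = centre G f m v

  -- The centre may fail to be a candidate, so `d≤4*bound` does not apply to it directly; but its
  -- radius is at most that of the candidate `v`.
  dist-centre : ∀ {m v} → φ v ≤ m → d v (centre G f m v) ≤ 4 * m
  dist-centre {m} {v} v-cand = begin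
    d v c              ≡⟨ d-sym v c ⟩
    d c v              ≤⟨ dist≤radius c v-cand ⟩
    radius G f m c     ≤⟨ centre-least G f m v v ⟩
    radius G f m v     ≤⟨ foldr-⊔-≤ (d v) (All.map (d≤4*bound v-cand) (all-filter (candidate? G f m) (allFin n))) ⟩
    4 * m              ∎
    where
    open ≤-Reasoning
    c = centre G f m v

-- Size of the branches at the centre

module TreeTour {n : ℕ} (G : Graph n) (connected : Connected G) (acyclic : ¬ HasCycle G) (f : Fin n → ℤ) where

  open Metric G connected
  open Prediction G connected f
  open Tree G connected acyclic
  open SpanningTour G connected f

  private
    d : Fin n → Fin n → ℕ
    d = dist G
    φ : Fin n → ℕ
    φ = errors G f

  module _ (m : ℕ) (v : Fin n) where

    private
      c : Fin n
      c = centre G f m v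

    -- If there were no such u, then b would have a smaller radius than c.
    opposite-candidate : ∀ {b s} (cb : Adj G c b) → φ s ≤ m → Beyond cb s →
                         ∃ λ u → φ u ≤ m × ¬ Beyond cb u × d c s ≤ suc (d c u)
    opposite-candidate {b} {s} cb s-cand bs
      with any? (λ u → candidate? G f m u ×-dec (¬? (beyond? cb u) ×-dec (d c s ≤? suc (d c u))))
    ... | yes found = found
    ... | no  none  = contradiction (centre-least G f m v b)
      (<⇒≱ (foldr-⊔-< (d b) (≤-trans (s≤s z≤n) (≤-trans (≤-reflexive (≡-sym bs)) s-near))
        (All.map closer (all-filter (candidate? G f m) (allFin n)))))
      where
      s-near = dist≤radius {m} c s-cand
      closer : ∀ {u} → φ u ≤ m → d b u < radius G f m c
      -- Candidates in the branch are closer to `b` than to `c` by 1. For the others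
      -- `d b u ≤ 1 + d c u < d c s`, because `u` fails to be the vertex sought.
      closer {u} u-cand with beyond? cb u
      ... | yes bu = ≤-trans (≤-reflexive (≡-sym bu)) (dist≤radius {m} c u-cand)
      ... | no ¬bu = ≤-trans (s≤s (d-adj-≤ u (Adj-sym G cb)))
        (≤-trans (≰⇒> λ cs≤ → none (u , u-cand , ¬bu , cs≤)) s-near)

    -- Adjacency is part of the predicate so that all `b` can be summed over, which produces the
    -- degree of `c`.
    branch? : ∀ b → Decidable (λ w → Adj G c b × d c w ≡ suc (d b w) × Spanned G f m c w)
    branch? b w = (adj G c b Bool.≟ true) ×-dec ((d c w ℕ.≟ suc (d b w)) ×-dec spanned? G f m c w)

    count-branch : ∀ b → count (branch? b) (allFin n) ≤ (if adj G c b then 1 else 0) * (m + m)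
    count-branch b = count-inhabited (branch? b) λ {w} (cb , bw , s , s-cand , cws) →
      ≤-trans (bounded cb s-cand (spanned-beyond cb bw cws))
              (≤-reflexive (≡-sym (trans (cong (λ e → (if e then 1 else 0) * (m + m)) cb) (*-identityˡ (m + m)))))
      where
      spanned-beyond : ∀ {w s} (cb : Adj G c b) → Beyond cb w → d c w + d w s ≡ d c s → Beyond cb s
      spanned-beyond {w} {s} cb bw cws = beyond cb (begin
        suc (d b s)             ≤⟨ s≤s (d-triangle b w s) ⟩
        suc (d b w) + d w s     ≡⟨ cong (_+ d w s) bw ⟨
        d c w + d w s           ≡⟨ cws ⟩
        d c s                   ∎)
        where open ≤-Reasoning
      bounded : ∀ {s} (cb : Adj G c b) → φ s ≤ m → Beyond cb s → count (branch? b) (allFin n) ≤ m + m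
      bounded {s} cb s-cand bs with opposite-candidate cb s-cand bs
      ... | u , u-cand , ¬bu , cs≤ =
        ≤-trans (count-separated (branch? b) s u λ {w} (_ , bw , _) → separates {w} bw) (+-mono-≤ s-cand u-cand)
        where
        separates : ∀ {w} → Beyond cb w → d w s ≢ d w u
        -- From `w` the way to `u` leads through `c` and has length at least `d b w + 1 + d c u`,
        -- the way to `s` has length at most `d b w + d b s`, and `d b s ≤ d c u` by the choice of
        -- `u`.
        separates {w} bw ws≡wu = contradiction (+-cancelˡ-≤ (d b w) _ _ (begin
          d b w + suc (d c u)     ≡⟨ +-suc (d b w) (d c u) ⟩
          suc (d b w) + d c u     ≡⟨ cong (_+ d c u) bw ⟨
          d c w + d c u           ≡⟨ cong (_+ d c u) (d-sym c w) ⟩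
          d w c + d c u           ≤⟨ beyond-separated cb bw ¬bu ⟩
          d w u                   ≡⟨ ws≡wu ⟨
          d w s                   ≤⟨ d-triangle w b s ⟩
          d w b + d b s           ≡⟨ cong (_+ d b s) (d-sym w b) ⟩
          d b w + d b s           ∎)) (<⇒≱ (s≤s (s≤s⁻¹ (≤-trans (≤-reflexive (≡-sym bs)) cs≤))))
          where open ≤-Reasoning

    count-inner : ∀ i → count (inner? m c i) (allFin n) ≤ maxDegree G * (m + m)
    count-inner i = begin
      count (inner? m c i) (allFin n)                                        ≤⟨ count-cover {P? = inner? m c i} {branch?} (allFin n) (allFin n) in-branch ⟩
      sum (map (λ b → count (branch? b) (allFin n)) (allFin n))              ≤⟨ sum-mono count-branch (allFin n) ⟩
      sum (map (λ b → (if adj G c b then 1 else 0) * (m + m)) (allFin n))    ≡⟨ sum-*ʳ (λ b → if adj G c b then 1 else 0) (m + m) (allFin n) ⟩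
      degree G c * (m + m)                                                   ≤⟨ *-monoˡ-≤ (m + m) (≤-foldr-⊔ (degree G) (∈-allFin c)) ⟩
      maxDegree G * (m + m)                                                  ∎
      where
      open ≤-Reasoning
      in-branch : ∀ {w} → Spanned G f m c w × 0 < d c w × d c w ≤ i →
                  ∃ λ b → b ∈ allFin n × Adj G c b × d c w ≡ suc (d b w) × Spanned G f m c w
      -- `b` is the first vertex after `c` on a shortest path from `c` to `w`.
      in-branch {w} (sp , 0<cw , _) with d-step (≡-sym (suc-pred (d c w) {{ℕ.>-nonZero 0<cw}}))
      ... | b , cb , eq = b , ∈-allFin b , cb ,
        trans (≡-sym (suc-pred (d c w) {{ℕ.>-nonZero 0<cw}})) (cong suc (≡-sym eq)) , sp

    walk-spanning-tour : φ v ≤ m → walk G v (spanning-tour G f m v) ≤ (4 + 4 * maxDegree G) * m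
    walk-spanning-tour v-cand = begin
      walk G v (spanning-tour G f m v)                ≤⟨ walk-layers m c v n ⟩
      d v c + count (inner? m c n) (allFin n) * 2     ≤⟨ +-mono-≤ (dist-centre v-cand) (*-monoˡ-≤ 2 (count-inner n)) ⟩
      4 * m + maxDegree G * (m + m) * 2               ≡⟨ regroup (maxDegree G) m ⟩
      (4 + 4 * maxDegree G) * m                       ∎
      where
      open ≤-Reasoning
      regroup : ∀ Δ m → 4 * m + Δ * (m + m) * 2 ≡ (4 + 4 * Δ) * m
      regroup = solve-∀

  -- Lets the terms in `k` without a factor `Δ` be absorbed into `Δ * k`.
  1≤maxDegree : ∀ {u v} → u ≢ v → 1 ≤ maxDegree G
  1≤maxDegree {u} {v} u≢v with d u v in eq
  ... | zero  = contradiction (d≡0⇒≡ eq) u≢v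
  ... | suc _ with d-step eq
  ...   | w , uw , _ = begin
    1                             ≡⟨ cong (λ e → if e then 1 else 0) uw ⟨
    (if adj G u w then 1 else 0)  ≤⟨ term≤sum (λ w → if adj G u w then 1 else 0) (∈-allFin w) ⟩
    degree G u                    ≤⟨ ≤-foldr-⊔ (degree G) (∈-allFin u) ⟩
    maxDegree G                   ∎
    where open ≤-Reasoning

tree-plan : Algorithm
tree-plan n G r f = plan G f (λ v m → spanning-tour G f m v) r

tree-plan-cost : ∀ n (G : Graph n) (r : Fin n) (f : Fin n → ℤ) (g : Fin n) → IsTree G →
                 CostAtMost tree-plan n G r f g (dist G r g + 68 * maxDegree G * errors G f g)
tree-plan-cost n G r f g (connected , acyclic) = Finds.found-at-cost (plan-finds-goal (r ≟ g))
  where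
  open Prediction G connected f
  open SpanningTour G connected f
  open TreeTour G connected acyclic f
  Δ K k : ℕ
  Δ = maxDegree G
  K = 4 + 4 * Δ
  k = errors G f g
  -- `4 * k + 4 * (4 + 4 * Δ) * 2 * k` is `36 * k + 32 * Δ * k`, and `36 + 32` is 68.
  bound : r ≢ g → dist G r g + (4 * k + 4 * (K * (k + k))) ≤ dist G r g + 68 * Δ * k
  bound r≢g = +-monoʳ-≤ (dist G r g) (begin
    4 * k + 4 * (K * (k + k))     ≡⟨ expand Δ k ⟩
    36 * (1 * k) + 32 * (Δ * k)   ≤⟨ +-monoˡ-≤ (32 * (Δ * k)) (*-monoʳ-≤ 36 (*-monoˡ-≤ k (1≤maxDegree r≢g))) ⟩
    36 * (Δ * k) + 32 * (Δ * k)   ≡⟨ collect Δ k ⟩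
    68 * Δ * k                    ∎)
    where
    open ≤-Reasoning
    expand : ∀ Δ k → 4 * k + 4 * ((4 + 4 * Δ) * (k + k)) ≡ 36 * (1 * k) + 32 * (Δ * k)
    expand = solve-∀
    collect : ∀ Δ k → 36 * (Δ * k) + 32 * (Δ * k) ≡ 68 * Δ * k
    collect = solve-∀
  plan-finds-goal : Dec (r ≡ g) → Finds G g r (tree-plan n G r f) (dist G r g + 68 * Δ * k)
  -- Covers the one-vertex tree, where `Δ` is 0 and the bound allows no cost beyond `d r g`.
  plan-finds-goal (yes r≡g) = subst (λ v → Finds G g v (tree-plan n G r f) (dist G r g + 68 * Δ * k)) (≡-sym r≡g)
    (finds-here G (tree-plan n G r f))
  plan-finds-goal (no r≢g)  = finds-mono G (bound r≢g) (plan-finds (λ v m → spanning-tour G f m v) (K *_) r g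
    (*-monoʳ-≤ K) (λ m → ≤-reflexive (≡-sym (*-distribˡ-+ K m m)))
    (λ {m} v<m → walk-spanning-tour m (best G f r) (<⇒≤ v<m))
    (λ {m} → candidate-∈-tour {m} (best G f r)))

mainTheorem3 : (Σ Algorithm λ A → Σ ℕ λ C →
    ∀ (n : ℕ) (G : Graph n) (r : Fin n) (f : Fin n → ℤ) (g : Fin n) →
    IsTree G →
    CostAtMost A n G r f g (dist G r g + C * maxDegree G * errors G f g))
    ×
    (Σ Algorithm λ A → Σ ℕ λ c → Σ ℕ λ C →
    ∀ (n : ℕ) (G : Graph n) (r : Fin n) (f : Fin n → ℤ) (g : Fin n) (α : ℕ) →
    Connected G → IsDoublingDim G α →
    CostAtMost A n G r f g
    (dist G r g + C * 2 ^ (c * α) * (errors G f g * errors G f g)))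
mainTheorem3 = (tree-plan , 68 , tree-plan-cost) , (doubling-plan , 4 , 132 , doubling-plan-cost)
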